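{- Let $G$ be a homogeneous $m$-generic $L$-graph. Then every $A\in O(G)$ is monic.
   Context: A language $L$ for coloured $m$-partite graphs specifies, for each pair of distinct $i,j\in\{0,\dots,m-1\}$, a finite nonempty set of colours $C_{ij}=C_{ji}$. An $L$-graph consists of a vertex set partitioned into parts $V_0,\dots,V_{m-1}$ (no edges inside a part) with a colour $F(x,y)=F(y,x)\in C_{ij}$ for all distinct $i,j$, $x\in V_i$, $y\in V_j$. Substructures are induced subgraphs; embeddings are injective, part-preserving, colour-preserving maps. $G$ is homogeneous if every isomorphism between finite induced subgraphs extends to an automorphism. $G$ is $m$-generic if every part is countably infinite and for all distinct $i,j$, every finite $U\subseteq V_i$ and every $f:U\to C_{ij}$ there is $x\in V_j$ with $F(x,u)=f(u)$ for all $u\in U$. A finite $L$-graph is realized in $G$ if it embeds in $G$, otherwise omitted; it is minimally omitted if omitted but all its proper induced subgraphs are realized. $O(G)$ is the class of finite $L$-graphs minimally omitted from $G$. A monic is a finite $L$-graph with at most one vertex in each part. -}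

module Defs where

open import Data.Nat using (ℕ; _≤_; _<_)
open import Data.Fin using (Fin)
open import Data.Fin.Subset using (Subset; _∈_) renaming (⊤ to Full)
open import Data.List using (List)
open import Data.List.Relation.Unary.All using (All)
open import Data.Product using (Σ; _×_)
open import Data.Unit using (⊤)
open import Data.Empty using (⊥)
open import Relation.Nullary using (¬_)
open import Relation.Binary.PropositionalEquality using (_≡_; _≢_)
open import Function.Bundles using (_↔_; Inverse)

-- A language for coloured m-partite graphs: colour set C_ij = {0, …, k i j - 1},
-- finite, nonempty for i ≢ j, and symmetric (C_ij = C_ji).
record Lang : Set where
  field
    m     : ℕ
    k     : Fin m → Fin m → ℕ
    k-sym : ∀ i j → k i j ≡ k j i
    k-pos : ∀ i j → i ≢ j → 1 ≤ k i j

-- An L-graph on vertex type V: partition into parts via `part`,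
-- colours F(x,y) ∈ C_{part x, part y} for vertices in distinct parts.
-- (Values of `col` on pairs inside one part are irrelevant: no edges there.)
record LGraph (L : Lang) (V : Set) : Set where
  open Lang L
  field
    part      : V → Fin m
    col       : V → V → ℕ
    col-sym   : ∀ x y → part x ≢ part y → col x y ≡ col y x
    col-bound : ∀ x y → part x ≢ part y → col x y < k (part x) (part y)

open LGraph public

module _ {L : Lang} where

  EmbedOn : {W V : Set} → LGraph L W → LGraph L V → (W → Set) → Set
  EmbedOn {W} {V} A G P =
    Σ (W → V) λ e →
      (∀ x y → P x → P y → e x ≡ e y → x ≡ y) ×
      (∀ x → P x → part G (e x) ≡ part A x) ×
      (∀ x y → P x → P y → part A x ≢ part A y →
         col G (e x) (e y) ≡ col A x y)

  Realized : {n : ℕ} {V : Set} → LGraph L (Fin n) → LGraph L V → Set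
  Realized A G = EmbedOn A G (λ _ → ⊤)

  MinOmitted : {n : ℕ} {V : Set} → LGraph L (Fin n) → LGraph L V → Set
  MinOmitted {n} A G =
    ¬ Realized A G ×
    (∀ (S : Subset n) → S ≢ Full → EmbedOn A G (λ x → x ∈ S))

  Monic : {n : ℕ} → LGraph L (Fin n) → Set
  Monic {n} A = ∀ (x y : Fin n) → part A x ≡ part A y → x ≡ y

  IsAutomorphism : {V : Set} → LGraph L V → (V ↔ V) → Set
  IsAutomorphism {V} G σ =
    (∀ x → part G (Inverse.to σ x) ≡ part G x) ×
    (∀ x y → part G x ≢ part G y →
       col G (Inverse.to σ x) (Inverse.to σ y) ≡ col G x y)

  -- Homogeneity: an isomorphism between finite induced subgraphs is given by
  -- two injective enumerations a, b : Fin r → V of the two vertex sets, with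
  -- a t ↦ b t part- and colour-preserving; it extends to an automorphism.
  Homogeneous : {V : Set} → LGraph L V → Set
  Homogeneous {V} G =
    ∀ (r : ℕ) (a b : Fin r → V) →
      (∀ s t → a s ≡ a t → s ≡ t) →
      (∀ s t → b s ≡ b t → s ≡ t) →
      (∀ t → part G (a t) ≡ part G (b t)) →
      (∀ s t → part G (a s) ≢ part G (a t) →
         col G (a s) (a t) ≡ col G (b s) (b t)) →
      Σ (V ↔ V) λ σ → IsAutomorphism G σ × (∀ t → Inverse.to σ (a t) ≡ b t)

  Generic : {V : Set} → LGraph L V → Set
  Generic {V} G =
    (∀ (i : Fin (Lang.m L)) → Σ V (λ x → part G x ≡ i) ↔ ℕ) ×
    (∀ (i j : Fin (Lang.m L)) → i ≢ j →
       (U : List V) → All (λ u → part G u ≡ i) U →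
       (f : V → ℕ) → All (λ u → f u < Lang.k L i j) U →
       Σ V λ x → part G x ≡ j × All (λ u → col G x u ≡ f u) U)

{-# OPTIONS --safe #-}

-- In G, no type over a finite set B has only finitely many realizations.  By
-- induction on B = b ∷ B′: suppose the type of x over B has finitely many
-- realizations, all in E, and put c = F(x,b), which is not the only colour between
-- the parts of x and b, or else b would impose nothing.  By the induction hypothesis the
-- type of x over B′ has infinitely many realizations, and homogeneity makes the
-- stabilizer of B′ so transitive on them that an automorphism fixing B′ and every
-- realization over B must fix b.  Choose q ≠ b of the same type as b over B′,
-- an automorphism τ fixing B′ with τ b = q, and by genericity some w ∉ E with
-- F(w,b) = c and F(w,q) ≠ c.  Then w does not have the type of x over B′, so
-- homogeneity gives σ fixing B′ and w and agreeing with τ on the realizations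
-- over B.  Hence τ⁻¹σ fixes b, so σ b = q, contradicting F(w,b) ≠ F(w,q).
--
-- If A ∈ O(G) had x ≠ y in one part, move an embedding of A ∖ x onto an embedding
-- of A ∖ y along A ∖ {x,y}; the image of y may collide with that of x, but its
-- type has another realization, so A would be realized.
module Submission where

open import Defs
open import Data.Nat using (ℕ; zero; suc; _≤_; _<_; z≤n; s≤s; _≤?_)
open import Data.Nat.Properties
  using (<-≤-trans; ≰⇒>; n<1⇒n≡0; <-irrefl)
open import Data.Fin using (Fin; zero; suc)
open import Data.Fin.Subset using (⁅_⁆; ∁) renaming (_∈_ to _∈ˢ_)
open import Data.Fin.Subset.Properties
  using (∈⊤; x∈∁p⇒x∉p; x∉p⇒x∈∁p; x≢y⇒x∉⁅y⁆; x∈⁅x⁆)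
open import Data.List using (List; []; _∷_; _++_; map; filter; lookup; length; allFin; deduplicate)
open import Data.List.Extrema.Nat using (max; xs≤max)
open import Data.List.Membership.Propositional using (_∈_; _∉_)
open import Data.List.Membership.Propositional.Properties
  using (∈-map⁺; ∈-map⁻; ∈-filter⁺; ∈-filter⁻; ∈-++⁺ˡ; ∈-++⁺ʳ; ∈-++⁻; ∈-allFin; ∈-lookup;
         ∈-deduplicate⁺; ∈-deduplicate⁻)
import Data.List.Membership.DecPropositional as DecMembership
open import Data.List.Relation.Unary.All as All using (All; []; _∷_)
open import Data.List.Relation.Unary.Any using (here; there; index)
open import Data.List.Relation.Unary.Any.Properties using (lookup-index)
open import Data.List.Relation.Unary.Unique.Propositional using (Unique)
open import Data.List.Relation.Unary.AllPairs using (_∷_)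
open import Data.List.Relation.Unary.Unique.DecPropositional.Properties using (deduplicate-!)
open import Data.Product using (Σ; ∃; _×_; _,_; proj₁; proj₂)
open import Data.Product.Properties using (≡-dec)
open import Data.Sum using (inj₁; inj₂)
open import Data.Empty using (⊥)
open import Function using (_∘_)
open import Function.Bundles using (_↔_; Inverse)
open import Function.Construct.Composition using (_↔-∘_)
open import Function.Construct.Symmetry using (↔-sym)
open import Relation.Nullary using (¬_; Dec; yes; no; contradiction)
open import Relation.Nullary.Decidable
  using (map′; _×-dec_; _→-dec_; ¬?; decidable-stable)
open import Relation.Binary.Definitions using (DecidableEquality)
open import Relation.Binary.PropositionalEquality
  using (_≡_; _≢_; refl; sym; trans; cong; cong₂; subst; subst₂)
import Data.Nat as ℕ
import Data.Fin as Fin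

lookup-injective : {A : Set} {xs : List A} → Unique xs →
                   ∀ i j → lookup xs i ≡ lookup xs j → i ≡ j
lookup-injective (_ ∷ _) zero zero _ = refl
lookup-injective (x∉ ∷ _) zero (suc j) eq = contradiction eq (All.lookup x∉ (∈-lookup j))
lookup-injective (x∉ ∷ _) (suc i) zero eq = contradiction (sym eq) (All.lookup x∉ (∈-lookup i))
lookup-injective (_ ∷ u) (suc i) (suc j) eq = cong suc (lookup-injective u i j eq)

other-colour : ∀ {k} → 2 ≤ k → ∀ c → ∃ λ d → d < k × d ≢ c
other-colour 2≤k zero    = 1 , 2≤k , λ ()
other-colour 2≤k (suc _) = 0 , <-≤-trans (s≤s z≤n) 2≤k , λ ()

module _ {L : Lang} {V : Set} (G : LGraph L V) where

  -- Automorphisms and pointwise stabilizers of finite sets.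

  Automorphism : Set
  Automorphism = Σ (V ↔ V) (IsAutomorphism G)

  infixr 8 _·_ _⁻¹·_

  _·_ _⁻¹·_ : Automorphism → V → V
  (σ , _) · v = Inverse.to σ v
  (σ , _) ⁻¹· v = Inverse.from σ v

  ·-⁻¹· : ∀ σ v → σ · σ ⁻¹· v ≡ v
  ·-⁻¹· (σ , _) = Inverse.strictlyInverseˡ σ

  ⁻¹·-· : ∀ σ v → σ ⁻¹· σ · v ≡ v
  ⁻¹·-· (σ , _) = Inverse.strictlyInverseʳ σ

  ·-injective : ∀ σ {u v} → σ · u ≡ σ · v → u ≡ v
  ·-injective σ {u} {v} eq =
    trans (sym (⁻¹·-· σ u)) (trans (cong (σ ⁻¹·_) eq) (⁻¹·-· σ v))

  part-· : ∀ σ v → part G (σ · v) ≡ part G v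
  part-· (_ , part≡ , _) = part≡

  col-· : ∀ σ u v → part G u ≢ part G v → col G (σ · u) (σ · v) ≡ col G u v
  col-· (_ , _ , col≡) = col≡

  infixr 9 _∙_

  _∙_ : Automorphism → Automorphism → Automorphism
  σ ∙ τ =
    proj₁ σ ↔-∘ proj₁ τ ,
    (λ v → trans (part-· σ (τ · v)) (part-· τ v)) ,
    (λ u v u≢v → trans
      (col-· σ (τ · u) (τ · v) (u≢v ∘ subst₂ _≡_ (part-· τ u) (part-· τ v)))
      (col-· τ u v u≢v))

  inv : Automorphism → Automorphism
  inv σ =
    ↔-sym (proj₁ σ) ,
    part-inv ,
    (λ u v u≢v → trans
      (sym (col-· σ _ _ (u≢v ∘ subst₂ _≡_ (part-inv u) (part-inv v))))
      (cong₂ (col G) (·-⁻¹· σ u) (·-⁻¹· σ v)))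
    where
    part-inv : ∀ v → part G (σ ⁻¹· v) ≡ part G v
    part-inv v = trans (sym (part-· σ (σ ⁻¹· v))) (cong (part G) (·-⁻¹· σ v))

  Fixes : List V → Automorphism → Set
  Fixes B σ = ∀ {b} → b ∈ B → σ · b ≡ b

  Fixes-∙ : ∀ {B} σ τ → Fixes B σ → Fixes B τ → Fixes B (σ ∙ τ)
  Fixes-∙ σ τ fσ fτ b∈B = trans (cong (σ ·_) (fτ b∈B)) (fσ b∈B)

  Fixes-inv : ∀ {B} σ → Fixes B σ → Fixes B (inv σ)
  Fixes-inv σ fσ {b} b∈B = trans (cong (σ ⁻¹·_) (sym (fσ b∈B))) (⁻¹·-· σ b)

  -- Types over a finite set of vertices.

  record SameType (B : List V) (u v : V) : Set where
    field
      ∉ˡ    : u ∉ B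
      ∉ʳ    : v ∉ B
      part≡ : part G u ≡ part G v
      col≡  : ∀ {b} → b ∈ B → part G u ≢ part G b → col G u b ≡ col G v b

  open SameType

  ST-refl : ∀ {B u} → u ∉ B → SameType B u u
  ST-refl u∉B = record { ∉ˡ = u∉B ; ∉ʳ = u∉B ; part≡ = refl ; col≡ = λ _ _ → refl }

  ST-sym : ∀ {B u v} → SameType B u v → SameType B v u
  ST-sym s = record
    { ∉ˡ = ∉ʳ s
    ; ∉ʳ = ∉ˡ s
    ; part≡ = sym (part≡ s)
    ; col≡ = λ b∈B v≢b → sym (col≡ s b∈B (v≢b ∘ trans (sym (part≡ s))))
    }

  ST-trans : ∀ {B u v w} → SameType B u v → SameType B v w → SameType B u w
  ST-trans s t = record
    { ∉ˡ = ∉ˡ s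
    ; ∉ʳ = ∉ʳ t
    ; part≡ = trans (part≡ s) (part≡ t)
    ; col≡ = λ b∈B u≢b → trans (col≡ s b∈B u≢b) (col≡ t b∈B (u≢b ∘ trans (part≡ s)))
    }

  ST-tail : ∀ {b B u v} → SameType (b ∷ B) u v → SameType B u v
  ST-tail s = record
    { ∉ˡ = ∉ˡ s ∘ there ; ∉ʳ = ∉ʳ s ∘ there ; part≡ = part≡ s ; col≡ = col≡ s ∘ there }

  ST-cons : ∀ {b B u v} → u ≢ b → v ≢ b → (part G u ≢ part G b → col G u b ≡ col G v b) →
            SameType B u v → SameType (b ∷ B) u v
  ST-cons u≢b v≢b eq s = record
    { ∉ˡ = λ { (here e) → u≢b e ; (there m) → ∉ˡ s m }
    ; ∉ʳ = λ { (here e) → v≢b e ; (there m) → ∉ʳ s m }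
    ; part≡ = part≡ s
    ; col≡ = λ { (here refl) → eq ; (there m) → col≡ s m }
    }

  ST-cons′ : ∀ {b B u v} → part G u ≢ part G b → col G u b ≡ col G v b →
             SameType B u v → SameType (b ∷ B) u v
  ST-cons′ u≢b eq s =
    ST-cons (u≢b ∘ cong (part G)) (u≢b ∘ trans (part≡ s) ∘ cong (part G)) (λ _ → eq) s

  ST-image : ∀ {B u} σ → Fixes B σ → u ∉ B → SameType B u (σ · u)
  ST-image {u = u} σ fσ u∉B = record
    { ∉ˡ = u∉B
    ; ∉ʳ = λ m → u∉B (subst (_∈ _) (·-injective σ (fσ m)) m)
    ; part≡ = sym (part-· σ u)
    ; col≡ = λ {b} b∈B u≢b →
        trans (sym (col-· σ u b u≢b)) (cong (col G (σ · u)) (fσ b∈B))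
    }

  ST-preimage : ∀ {B u} σ → Fixes B σ → σ · u ∉ B → SameType B u (σ · u)
  ST-preimage σ fσ σu∉B =
    ST-image σ fσ (λ u∈B → σu∉B (subst (_∈ _) (sym (fσ u∈B)) u∈B))

  -- Consequences of genericity.

  module _ (gen : Generic G) where

    vertices : ∀ i → Σ V (λ v → part G v ≡ i) ↔ ℕ
    vertices = proj₁ gen

    rank : V → ℕ
    rank v = Inverse.to (vertices (part G v)) (v , refl)

    vertex : ∀ i → ℕ → V
    vertex i n = proj₁ (Inverse.from (vertices i) n)

    part-vertex : ∀ i n → part G (vertex i n) ≡ i
    part-vertex i n = proj₂ (Inverse.from (vertices i) n)

    rank-to : ∀ {i} v (e : part G v ≡ i) → rank v ≡ Inverse.to (vertices i) (v , e)
    rank-to v refl = refl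

    rank-vertex : ∀ i n → rank (vertex i n) ≡ n
    rank-vertex i n =
      trans (rank-to _ (part-vertex i n)) (Inverse.strictlyInverseˡ (vertices i) n)

    vertex-rank : ∀ v → vertex (part G v) (rank v) ≡ v
    vertex-rank v = cong proj₁ (Inverse.strictlyInverseʳ (vertices (part G v)) (v , refl))

    -- A vertex is determined by its part and its rank there, so equality is decidable although `V`
    -- is an arbitrary type. All later case distinctions on membership and types rest on this.
    _≟_ : DecidableEquality V
    u ≟ v = map′
      (λ { (p , r) → trans (sym (vertex-rank u))
                           (trans (subst₂ (λ i n → vertex (part G u) (rank u) ≡ vertex i n) p r refl)
                                  (vertex-rank v)) })
      (λ { refl → refl , refl })
      ((part G u Fin.≟ part G v) ×-dec (rank u ℕ.≟ rank v))

    open DecMembership _≟_ using (_∈?_; _∉?_)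

    part-infinite : ∀ i (E : List V) → ∃ λ v → v ∉ E × part G v ≡ i
    part-infinite i E = vertex i (suc N) , fresh , part-vertex i (suc N)
      where
      N = max 0 (map rank E)
      fresh : vertex i (suc N) ∉ E
      fresh m = <-irrefl refl
        (subst (_≤ N) (rank-vertex i (suc N)) (All.lookup (xs≤max 0 (map rank E)) (∈-map⁺ rank m)))

    SameType? : ∀ B u v → Dec (SameType B u v)
    SameType? B u v = map′
      (λ { (p , q , r , s) → record
           { ∉ˡ = p ; ∉ʳ = q ; part≡ = r ; col≡ = λ m → All.lookup s m } })
      (λ s → ∉ˡ s , ∉ʳ s , part≡ s , All.tabulate (col≡ s))
      ((u ∉? B) ×-dec (v ∉? B) ×-dec (part G u Fin.≟ part G v) ×-dec
       All.all? (λ b → ¬? (part G u Fin.≟ part G b) →-dec (col G u b ℕ.≟ col G v b)) B)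

    _[_↦_] : (V → ℕ) → V → ℕ → V → ℕ
    (f [ q ↦ d ]) v with v ≟ q
    ... | yes _ = d
    ... | no _ = f v

    update-at : ∀ f q d → (f [ q ↦ d ]) q ≡ d
    update-at f q d with q ≟ q
    ... | yes _ = refl
    ... | no q≢q = contradiction refl q≢q

    update-off : ∀ f {q d v} → v ≢ q → (f [ q ↦ d ]) v ≡ f v
    update-off f {q} {v = v} v≢q with v ≟ q
    ... | yes v≡q = contradiction v≡q v≢q
    ... | no _ = refl

    -- Each e ∈ E is avoided by prescribing at a fresh vertex q a colour other than F(e,q).
    generic-infinite : ∀ {i j} → i ≢ j → 2 ≤ Lang.k L i j →
      (U : List V) → All (λ u → part G u ≡ i) U →
      (f : V → ℕ) → All (λ u → f u < Lang.k L i j) U → (E : List V) →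
      ∃ λ x → x ∉ E × part G x ≡ j × All (λ u → col G x u ≡ f u) U
    generic-infinite {i} {j} i≢j 2≤k U U⊆i f f<k [] with proj₂ gen i j i≢j U U⊆i f f<k
    ... | x , x∈j , x-f = x , (λ ()) , x∈j , x-f
    generic-infinite {i} {j} i≢j 2≤k U U⊆i f f<k (e ∷ E) with part-infinite i U
    ... | q , q∉U , q∈i with other-colour 2≤k (col G e q)
    ... | d , d<k , d≢ with generic-infinite i≢j 2≤k (q ∷ U) (q∈i ∷ U⊆i) (f [ q ↦ d ])
              (subst (_< _) (sym (update-at f q d)) d<k ∷
               All.tabulate (λ m → subst (_< _) (sym (update-off f (off m))) (All.lookup f<k m)))
              E
      where
      off : ∀ {u} → u ∈ U → u ≢ q
      off m refl = q∉U m
    ... | x , x∉E , x∈j , (x-q ∷ x-U) =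
      x ,
      (λ { (here refl) → d≢ (sym (trans x-q (update-at f q d))) ; (there m) → x∉E m }) ,
      x∈j ,
      All.tabulate (λ m → trans (All.lookup x-U m) (update-off f (λ { refl → q∉U m })))

    separating : ∀ {i j} → i ≢ j → 2 ≤ Lang.k L i j →
      ∀ {b q} → part G b ≡ i → part G q ≡ i → q ≢ b →
      ∀ {c d} → c < Lang.k L i j → d < Lang.k L i j → (E : List V) →
      ∃ λ x → x ∉ E × part G x ≡ j × col G x b ≡ c × col G x q ≡ d
    separating i≢j 2≤k {b} {q} b∈i q∈i q≢b {c} {d} c<k d<k E
      with generic-infinite i≢j 2≤k (b ∷ q ∷ []) (b∈i ∷ q∈i ∷ []) ((λ _ → d) [ b ↦ c ])
             (subst (_< _) (sym (update-at _ b c)) c<k ∷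
              subst (_< _) (sym (update-off _ q≢b)) d<k ∷ []) E
    ... | x , x∉E , x∈j , (x-b ∷ x-q ∷ []) =
      x , x∉E , x∈j , trans x-b (update-at _ b c) , trans x-q (update-off _ q≢b)

    -- Extension of finite partial isomorphisms.

    module _ (hom : Homogeneous G) where

      -- Homogeneity asks for injective enumerations, but `ps` may repeat a pair. Pairs that agree
      -- in one coordinate agree in the other, so after removing duplicates both projections are
      -- injective.
      extend-iso : (ps : List (V × V)) →
        (∀ {a b} → (a , b) ∈ ps → part G a ≡ part G b) →
        (∀ {a b a′ b′} → (a , b) ∈ ps → (a′ , b′) ∈ ps →
          (a ≡ a′ → b ≡ b′) × (b ≡ b′ → a ≡ a′) ×
          (part G a ≢ part G a′ → col G a a′ ≡ col G b b′)) →
        Σ Automorphism λ σ → ∀ {a b} → (a , b) ∈ ps → σ · a ≡ b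
      extend-iso ps parts iso = (proj₁ ext , proj₁ (proj₂ ext)) , maps
        where
        qs = deduplicate (≡-dec _≟_ _≟_) ps

        uniq : ∀ s t → lookup qs s ≡ lookup qs t → s ≡ t
        uniq = lookup-injective (deduplicate-! (≡-dec _≟_ _≟_) ps)

        mem : ∀ t → lookup qs t ∈ ps
        mem t = ∈-deduplicate⁻ (≡-dec _≟_ _≟_) ps (∈-lookup t)

        ext = hom (length qs) (proj₁ ∘ lookup qs) (proj₂ ∘ lookup qs)
          (λ s t eq → uniq s t (cong₂ _,_ eq (proj₁ (iso (mem s) (mem t)) eq)))
          (λ s t eq → uniq s t (cong₂ _,_ (proj₁ (proj₂ (iso (mem s) (mem t))) eq) eq))
          (λ t → parts (mem t))
          (λ s t → proj₂ (proj₂ (iso (mem s) (mem t))))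

        maps : ∀ {a b} → (a , b) ∈ ps → Inverse.to (proj₁ ext) a ≡ b
        maps {a} {b} m =
          subst (λ p → Inverse.to (proj₁ ext) (proj₁ p) ≡ proj₂ p)
            (sym (lookup-index m′)) (proj₂ (proj₂ ext) (index m′))
          where m′ = ∈-deduplicate⁺ (≡-dec _≟_ _≟_) m

      -- Vertices of one part carry no structure besides equality, so only their
      -- types over B matter.
      extend-types : ∀ B (ps : List (V × V)) →
        (∀ {u v} → (u , v) ∈ ps → SameType B u v) →
        (∀ {u v u′ v′} → (u , v) ∈ ps → (u′ , v′) ∈ ps →
          part G u ≡ part G u′ × (u ≡ u′ → v ≡ v′) × (v ≡ v′ → u ≡ u′)) →
        Σ Automorphism λ σ → Fixes B σ × (∀ {u v} → (u , v) ∈ ps → σ · u ≡ v)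
      extend-types B ps types inj =
        proj₁ ext , proj₂ ext ∘ ∈-++⁺ˡ ∘ ∈-map⁺ (λ b → b , b) , proj₂ ext ∘ ∈-++⁺ʳ Δ
        where
        Δ = map (λ b → b , b) B

        Iso : V → V → V → V → Set
        Iso a b a′ b′ = (a ≡ a′ → b ≡ b′) × (b ≡ b′ → a ≡ a′) ×
          (part G a ≢ part G a′ → col G a a′ ≡ col G b b′)

        isoΔ : ∀ {c u v} → c ∈ B → SameType B u v → Iso c c u v
        isoΔ {c} {u} {v} c∈B s =
          (λ { refl → contradiction c∈B (∉ˡ s) }) ,
          (λ { refl → contradiction c∈B (∉ʳ s) }) ,
          (λ c≢u → trans (col-sym G c u c≢u) (trans (col≡ s c∈B (c≢u ∘ sym))
            (col-sym G v c (c≢u ∘ sym ∘ trans (part≡ s)))))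

        iso : ∀ {a b a′ b′} → (a , b) ∈ Δ ++ ps → (a′ , b′) ∈ Δ ++ ps → Iso a b a′ b′
        iso m m′ with ∈-++⁻ Δ m | ∈-++⁻ Δ m′
        ... | inj₁ n | inj₁ n′ with ∈-map⁻ _ n | ∈-map⁻ _ n′
        ...   | _ , _ , refl | _ , _ , refl = (λ e → e) , (λ e → e) , (λ _ → refl)
        iso m m′ | inj₁ n | inj₂ n′ with ∈-map⁻ _ n
        ... | _ , c∈B , refl = isoΔ c∈B (types n′)
        iso {a} {b} {a′} m m′ | inj₂ n | inj₁ n′ with ∈-map⁻ _ n′
        ... | _ , c∈B , refl with isoΔ c∈B (types n)
        ...   | f , g , _ =
          sym ∘ f ∘ sym , sym ∘ g ∘ sym , col≡ (types n) c∈B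
        iso m m′ | inj₂ n | inj₂ n′ with inj n n′
        ... | p , f , g = f , g , (λ p≢ → contradiction p p≢)

        parts : ∀ {a b} → (a , b) ∈ Δ ++ ps → part G a ≡ part G b
        parts m with ∈-++⁻ Δ m
        ... | inj₂ n = part≡ (types n)
        ... | inj₁ n with ∈-map⁻ _ n
        ...   | _ , _ , refl = refl

        ext = extend-iso (Δ ++ ps) parts iso

      move : ∀ {B u v} → SameType B u v →
        Σ Automorphism λ σ → Fixes B σ × σ · u ≡ v
      move {B} {u} {v} s with extend-types B ((u , v) ∷ [])
        (λ { (here refl) → s })
        (λ { (here refl) (here refl) → refl , (λ _ → refl) , (λ _ → refl) })
      ... | σ , fσ , σ-ps = σ , fσ , σ-ps (here refl)

      -- As `b` shares a part with `u` and `v`, no colour joins it to them; fixing it too only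
      -- requires that both differ from it.
      move-off : ∀ {B b u v} → b ∉ B → part G b ≡ part G u → u ≢ b → v ≢ b → SameType B u v →
        Σ Automorphism λ σ → Fixes B σ × σ · b ≡ b × σ · u ≡ v
      move-off {B} {b} {u} {v} b∉B p u≢b v≢b s
        with extend-types B ((b , b) ∷ (u , v) ∷ [])
        (λ { (here refl) → ST-refl b∉B ; (there (here refl)) → s })
        (λ { (here refl) (here refl) → refl , (λ _ → refl) , (λ _ → refl)
           ; (here refl) (there (here refl)) →
               p , (λ e → contradiction (sym e) u≢b) , (λ e → contradiction (sym e) v≢b)
           ; (there (here refl)) (here refl) →
               sym p , (λ e → contradiction e u≢b) , (λ e → contradiction e v≢b)
           ; (there (here refl)) (there (here refl)) → refl , (λ _ → refl) , (λ _ → refl) })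
      ... | σ , fσ , σ-ps = σ , fσ , σ-ps (here refl) , σ-ps (there (here refl))

      -- If ρ b ≠ b, then already every z of the type of x over B would satisfy
      -- F(z,b) = F(x,b).
      fixes-definer : ∀ {B b x z} → b ∉ B → part G x ≢ part G b →
        SameType B x z → col G x b ≢ col G z b →
        ∀ ρ → Fixes B ρ → (∀ {u} → SameType (b ∷ B) x u → ρ · u ≡ u) → ρ · b ≡ b
      fixes-definer {B} {b} {x} {z} b∉B x≢b xz x≢z ρ fρ ρ-fix =
        decidable-stable ((ρ · b) ≟ b) moved
        where
        z≢b : part G z ≢ part G b
        z≢b = x≢b ∘ trans (part≡ xz)

        moved : ¬ ρ · b ≢ b
        moved ρb≢b with move xz
        -- Since F(x,b) = F(z, θ b) while F(x,b) and F(z,b) differ, `θ` moves `b`. So ρ b and θ b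
        -- both differ from `b` and have its type over `B`, which yields `φ` fixing `B` and `b` with
        -- φ ρ b = θ b.
        ... | θ , fθ , θx with move-off {b = b} {u = ρ · b} {v = θ · b} b∉B (sym (part-· ρ b)) ρb≢b
                (λ θb → x≢z (trans (sym (col-· θ x b x≢b)) (cong₂ (col G) θx θb)))
                (ST-trans (ST-sym (ST-image ρ fρ b∉B)) (ST-image θ fθ b∉B))
        ... | φ , fφ , φb , φρb = x≢z (trans xv (trans (sym (col-· φ v b v≢b))
                (cong₂ (col G) φv φb)))
          where
          -- Chosen so that φρ takes `v` to `z` and `b` to θ b; hence F(v,b) = F(z, θ b) = F(x,b).
          v = ρ ⁻¹· φ ⁻¹· z

          φρv : φ · ρ · v ≡ z
          φρv = trans (cong (φ ·_) (·-⁻¹· ρ _)) (·-⁻¹· φ z)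

          zv : SameType B z v
          zv = subst (λ y → SameType B y v) φρv
            (ST-sym (ST-preimage (φ ∙ ρ) (Fixes-∙ φ ρ fφ fρ) (∉ʳ xz ∘ subst (_∈ B) φρv)))

          v≢b : part G v ≢ part G b
          v≢b = z≢b ∘ trans (part≡ zv)

          xv : col G x b ≡ col G v b
          xv = trans (sym (col-· θ x b x≢b)) (trans (cong₂ (col G) (trans θx (sym φρv)) (sym φρb))
            (col-· (φ ∙ ρ) v b v≢b))

          -- Now `v` has the type of `x` over `b ∷ B`, so `ρ` fixes it. As `φ` also fixes `b`,
          -- F(z,b) = F(v,b) = F(x,b).
          φv : φ · v ≡ z
          φv = trans (cong (φ ·_) (sym (ρ-fix (ST-cons′ x≢b xv (ST-trans xz zv))))) φρv

      -- Infinitely many realizations of every type.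

      -- Infinitude means that no finite list `E` exhausts the realizations. The double negation
      -- reflects that the inductive step refutes exhaustion without exhibiting `y`; it suffices
      -- because each use has goal `⊥`.
      InfiniteTypes : List V → Set
      InfiniteTypes B = ∀ {x} → x ∉ B → ∀ E → ¬ ¬ (∃ λ y → y ∉ E × SameType B x y)

      infinite-step : ∀ {b B} → InfiniteTypes B → b ∉ B →
        ∀ {x} → x ∉ B → part G x ≢ part G b → 2 ≤ Lang.k L (part G b) (part G x) →
        ∀ E → ¬ ¬ (∃ λ y → y ∉ E × SameType (b ∷ B) x y)
      infinite-step {b} {B} ih b∉B {x} x∉B x≢b 2≤k E none =
        -- As `z` is outside `E`, it cannot realize the type over `b ∷ B`, so F(z,b) differs from
        -- F(x,b), as `fixes-definer` demands.
        ih x∉B E λ { (z , z∉E , xz) →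
        ih b∉B (b ∷ []) λ { (q , q∉ , bq) → step z∉E xz (q∉ ∘ here) bq } }
        where
        inE : ∀ {u} → SameType (b ∷ B) x u → u ∈ E
        inE {u} s = decidable-stable (u ∈? E) (λ u∉E → none (u , u∉E , s))

        step : ∀ {z q} → z ∉ E → SameType B x z → q ≢ b → SameType B b q → ⊥
        step {z} {q} z∉E xz q≢b bq
          with other-colour 2≤k (col G x b) | move bq
        ... | d , d<k , d≢ | τ , fτ , τb
          with separating (x≢b ∘ sym) 2≤k refl (sym (part≡ bq)) q≢b
                 (subst (col G x b <_) (Lang.k-sym L _ _) (col-bound G x b x≢b)) d<k E
        ... | w , w∉E , w∈i , wb , wq = d≢ (trans (sym wq) (trans (sym wbq) wb))
          where
          w≢b : part G w ≢ part G b
          w≢b = x≢b ∘ trans (sym w∈i)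

          -- `b` and `q` have the same type over `B`, so no member of `B` tells them apart, whereas
          -- `w` does.
          w∉B : w ∉ B
          w∉B m = d≢ (trans (sym wq) (trans (col-sym G w q (w≢b ∘ λ e → trans e (sym (part≡ bq))))
            (trans (sym (col≡ bq m (w≢b ∘ sym))) (trans (col-sym G b w (w≢b ∘ sym)) wb))))

          w-type : ¬ SameType B x w
          w-type s = w∉E (inE (ST-cons′ x≢b (sym wb) s))

          -- By `inE` this lists all realizations of the type of `x` over `b ∷ B`.
          es = filter (SameType? (b ∷ B) x) E

          ps = map (λ e → e , τ · e) es

          on-ps : ∀ {u v} → (u , v) ∈ ps → SameType B x u × v ≡ τ · u
          on-ps m with ∈-map⁻ _ m
          ... | e , e∈ , refl =
            ST-tail (proj₂ (∈-filter⁻ (SameType? (b ∷ B) x) {xs = E} e∈)) , refl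

          x-image : ∀ {u v} → (u , v) ∈ ps → SameType B u v
          x-image m with on-ps m
          ... | s , refl = ST-image τ fτ (∉ʳ s)

          inj : ∀ {u v u′ v′} → (u , v) ∈ (w , w) ∷ ps → (u′ , v′) ∈ (w , w) ∷ ps →
                part G u ≡ part G u′ × (u ≡ u′ → v ≡ v′) × (v ≡ v′ → u ≡ u′)
          inj (here refl) (here refl) = refl , (λ _ → refl) , (λ _ → refl)
          -- A listed realization and its image under `τ` both have the type of `x` over `B`, so
          -- neither is `w`.
          inj (here refl) (there m) with proj₁ (on-ps m) | x-image m
          ... | s | t = trans w∈i (part≡ s) ,
            (λ { refl → contradiction s w-type }) ,
            (λ { refl → contradiction (ST-trans s t) w-type })
          inj (there m) (here refl) with proj₁ (on-ps m) | x-image m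
          ... | s | t = trans (sym (part≡ s)) (sym w∈i) ,
            (λ { refl → contradiction s w-type }) ,
            (λ { refl → contradiction (ST-trans s t) w-type })
          inj (there m) (there m′) with on-ps m | on-ps m′
          ... | s , refl | s′ , refl =
            trans (sym (part≡ s)) (part≡ s′) , cong (τ ·_) , ·-injective τ

          ext = extend-types B ((w , w) ∷ ps)
            (λ { (here refl) → ST-refl w∉B ; (there m) → x-image m }) inj

          σ = proj₁ ext

          fσ : Fixes B σ
          fσ = proj₁ (proj₂ ext)

          ρ = inv τ ∙ σ

          -- `σ` and `τ` agree on `es`, so `ρ` fixes every realization over `b ∷ B`, and therefore
          -- `b`.
          ρb : ρ · b ≡ b
          ρb = fixes-definer b∉B x≢b xz
            (λ xb≡zb → z∉E (inE (ST-cons′ x≢b xb≡zb xz)))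
            ρ (Fixes-∙ (inv τ) σ (Fixes-inv τ fτ) fσ)
            (λ {u} s → trans
              (cong (τ ⁻¹·_) (proj₂ (proj₂ ext)
                (there (∈-map⁺ _ (∈-filter⁺ (SameType? (b ∷ B) x) (inE s) s)))))
              (⁻¹·-· τ u))

          σb : σ · b ≡ q
          σb = trans (sym (·-⁻¹· τ (σ · b))) (trans (cong (τ ·_) ρb) τb)

          wbq : col G w b ≡ col G w q
          wbq = trans (sym (col-· σ w b w≢b)) (cong₂ (col G) (proj₂ (proj₂ ext) (here refl)) σb)

      -- Induction on `B`, starting from the infinitude of the parts. Only a new `b` in another part
      -- than `x`, with at least two colours between the parts, calls for `infinite-step`.
      infinite-types : ∀ B → InfiniteTypes B
      infinite-types [] {x} _ E none with part-infinite (part G x) E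
      ... | y , y∉E , p = none (y , y∉E , record
        { ∉ˡ = λ () ; ∉ʳ = λ () ; part≡ = sym p ; col≡ = λ () })
      infinite-types (b ∷ B) {x} x∉ E none
        with b ∈? B | part G x Fin.≟ part G b | 2 ≤? Lang.k L (part G b) (part G x)
      ... | no b∉B | no x≢b | yes 2≤k =
        infinite-step (infinite-types B) b∉B (x∉ ∘ there) x≢b 2≤k E none
      ... | yes b∈B | _ | _ =
        infinite-types B (x∉ ∘ there) E λ { (y , y∉E , s) → none (y , y∉E ,
          ST-cons (x∉ ∘ here) (λ { refl → ∉ʳ s b∈B }) (col≡ s b∈B) s) }
      -- Within one part `b` only has to be avoided, so it joins the excluded list.
      ... | _ | yes p | _ =
        infinite-types B (x∉ ∘ there) (b ∷ E) λ { (y , y∉ , s) → none (y , y∉ ∘ there ,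
          ST-cons (x∉ ∘ here) (y∉ ∘ here) (contradiction p) s) }
      -- Only colour 0 is available here, so the colours to `b` agree automatically.
      ... | no _ | no x≢b | no k≱2 =
        infinite-types B (x∉ ∘ there) E λ { (y , y∉E , s) → none (y , y∉E ,
          ST-cons′ x≢b (trans (mono x x≢b refl) (sym (mono y (x≢b ∘ trans (part≡ s)) (part≡ s)))) s) }
        where
        mono : ∀ u → part G u ≢ part G b → part G x ≡ part G u → col G u b ≡ 0
        mono u u≢b p = n<1⇒n≡0 (<-≤-trans (col-bound G u b u≢b)
          (subst (_≤ 1) (trans (Lang.k-sym L _ _) (cong (λ i → Lang.k L i (part G b)) p))
            (ℕ.s≤s⁻¹ (≰⇒> k≱2))))

-- Amalgamating two vertex-deleted copies of a minimally omitted graph.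

theorem2p2 : (L : Lang) {V : Set} (G : LGraph L V) → Homogeneous G → Generic G →
    (n : ℕ) (A : LGraph L (Fin n)) → MinOmitted A G → Monic A
theorem2p2 L {V} G hom gen n A (omitted , minimal) x y x~y =
  decidable-stable (x Fin.≟ y) realize
  where
  delete : ∀ p → EmbedOn A G (λ u → u ∈ˢ ∁ ⁅ p ⁆)
  delete p = minimal (∁ ⁅ p ⁆) (λ full →
    x∈∁p⇒x∉p (subst (p ∈ˢ_) (sym full) ∈⊤) (x∈⁅x⁆ p))

  keep : ∀ {p u} → u ≢ p → u ∈ˢ ∁ ⁅ p ⁆
  keep = x∉p⇒x∈∁p ∘ x≢y⇒x∉⁅y⁆

  module _ (x≢y : x ≢ y) where

    rest : List (Fin n)
    rest = filter (λ u → ¬? (u Fin.≟ x) ×-dec ¬? (u Fin.≟ y)) (allFin n)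

    ∈-rest⁺ : ∀ {u} → u ≢ x → u ≢ y → u ∈ rest
    ∈-rest⁺ {u} u≢x u≢y = ∈-filter⁺ _ (∈-allFin u) (u≢x , u≢y)

    ∈-rest⁻ : ∀ {u} → u ∈ rest → u ≢ x × u ≢ y
    ∈-rest⁻ = proj₂ ∘ ∈-filter⁻ _ {xs = allFin n}

    realize : ⊥
    realize with delete x | delete y
    ... | f , f-inj , f-part , f-col | g , g-inj , g-part , g-col =
      -- `y′` is related to `B` as `y` is to `rest`, but it may equal `g x`; hence a realization of
      -- its type avoiding `g x`.
      infinite-types G gen hom B y′∉B (g x ∷ []) λ { (y″ , y″∉ , s) →
        omitted (embed y″ (y″∉ ∘ here) s) }
      where
      toX : ∀ {u} → u ∈ rest → u ∈ˢ ∁ ⁅ x ⁆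
      toX = keep ∘ proj₁ ∘ ∈-rest⁻
      toY : ∀ {u} → u ∈ rest → u ∈ˢ ∁ ⁅ y ⁆
      toY = keep ∘ proj₂ ∘ ∈-rest⁻
      ext = extend-iso G gen hom (map (λ u → f u , g u) rest) parts iso
        where
        parts : ∀ {a b} → (a , b) ∈ map (λ u → f u , g u) rest → part G a ≡ part G b
        parts m with ∈-map⁻ _ m
        ... | u , u∈ , refl = trans (f-part u (toX u∈)) (sym (g-part u (toY u∈)))
        iso : ∀ {a b a′ b′} → (a , b) ∈ map (λ u → f u , g u) rest →
              (a′ , b′) ∈ map (λ u → f u , g u) rest →
              (a ≡ a′ → b ≡ b′) × (b ≡ b′ → a ≡ a′) ×
              (part G a ≢ part G a′ → col G a a′ ≡ col G b b′)
        iso m m′ with ∈-map⁻ _ m | ∈-map⁻ _ m′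
        ... | u , u∈ , refl | v , v∈ , refl =
          cong g ∘ f-inj u v (toX u∈) (toX v∈) ,
          cong f ∘ g-inj u v (toY u∈) (toY v∈) ,
          (λ u≢v → let u≢v′ = λ e → u≢v (trans (f-part u (toX u∈)) (trans e (sym (f-part v (toX v∈)))))
                   in trans (f-col u v (toX u∈) (toX v∈) u≢v′) (sym (g-col u v (toY u∈) (toY v∈) u≢v′)))
      σ = proj₁ ext
      σf : ∀ {u} → u ∈ rest → _·_ G σ (f u) ≡ g u
      σf u∈ = proj₂ ext (∈-map⁺ _ u∈)
      B = map g rest
      y′ = _·_ G σ (f y)
      y′∉B : y′ ∉ B
      y′∉B m with ∈-map⁻ _ m
      ... | u , u∈ , eq = proj₂ (∈-rest⁻ u∈)
        (sym (f-inj y u (keep (x≢y ∘ sym)) (toX u∈) (·-injective G σ (trans eq (sym (σf u∈))))))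
      embed : ∀ y″ → y″ ≢ g x → SameType G B y′ y″ → Realized A G
      embed y″ y″≢ s = h , (λ u v _ _ → h-inj u v) , (λ u _ → h-part u) , (λ u v _ _ → h-col u v)
        where
        open SameType s
        -- `g` is an embedding only away from `y`; its value at `y` is arbitrary and is replaced.
        h : Fin n → V
        h u with u Fin.≟ y
        ... | yes _ = y″
        ... | no _ = g u
        fresh : ∀ {u} → u ≢ y → y″ ≢ g u
        fresh {u} u≢y e with u Fin.≟ x
        ... | yes refl = y″≢ e
        ... | no u≢x = ∉ʳ (subst (_∈ B) (sym e) (∈-map⁺ g (∈-rest⁺ u≢x u≢y)))
        y″-part : part G y″ ≡ part A y
        y″-part = trans (sym part≡) (trans (part-· G σ (f y)) (f-part y (keep (x≢y ∘ sym))))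
        y″-col : ∀ {u} → u ≢ y → part A y ≢ part A u → col G y″ (g u) ≡ col A y u
        y″-col {u} u≢y y≢u =
          trans (sym (col≡ (∈-map⁺ g u∈) (λ e → fy≢fu (trans (sym (part-· G σ (f y)))
                   (trans e (trans (cong (part G) (sym (σf u∈))) (part-· G σ (f u))))))))
          (trans (cong (col G y′) (sym (σf u∈)))
          (trans (col-· G σ (f y) (f u) fy≢fu)
                 (f-col y u (keep (x≢y ∘ sym)) (toX u∈) y≢u)))
          where
          u∈ : u ∈ rest
          -- The shared part of `x` and `y` enters here: no colour between `y″` and `g x` has to be
          -- matched, so `u` is not `x`.
          u∈ = ∈-rest⁺ (λ { refl → y≢u (sym x~y) }) u≢y
          fy≢fu : part G (f y) ≢ part G (f u)
          fy≢fu e = y≢u (trans (sym (f-part y (keep (x≢y ∘ sym)))) (trans e (f-part u (toX u∈))))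
        h-inj : ∀ u v → h u ≡ h v → u ≡ v
        h-inj u v e with u Fin.≟ y | v Fin.≟ y
        ... | yes u≡y | yes v≡y = trans u≡y (sym v≡y)
        ... | yes _ | no v≢y = contradiction e (fresh v≢y)
        ... | no u≢y | yes _ = contradiction (sym e) (fresh u≢y)
        ... | no u≢y | no v≢y = g-inj u v (keep u≢y) (keep v≢y) e
        h-part : ∀ u → part G (h u) ≡ part A u
        h-part u with u Fin.≟ y
        ... | yes refl = y″-part
        ... | no u≢y = g-part u (keep u≢y)
        h-col : ∀ u v → part A u ≢ part A v → col G (h u) (h v) ≡ col A u v
        h-col u v u≢v with u Fin.≟ y | v Fin.≟ y
        ... | yes refl | yes refl = contradiction refl u≢v
        ... | yes refl | no v≢y = y″-col v≢y u≢v
        ... | no u≢y | yes refl =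
          trans (col-sym G (g u) y″ (λ e → u≢v (trans (sym (g-part u (keep u≢y))) (trans e y″-part))))
            (trans (y″-col u≢y (u≢v ∘ sym)) (col-sym A y u (u≢v ∘ sym)))
        ... | no u≢y | no v≢y = g-col u v (keep u≢y) (keep v≢y) u≢v
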